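{- A graph $G$ obtained by edge-pasting together partial cubes $G_1$ and $G_2$ is a partial cube.
   Context: Graphs are simple, undirected, nonempty, and not necessarily finite. For a set $X$, the hypercube $\mathcal H(X)$ is the graph whose vertices are the finite subsets of $X$, with $P,Q$ adjacent iff $|P\Delta Q|=1$. A graph is a partial cube if it can be isometrically embedded (i.e. by a map preserving shortest-path distances) into some $\mathcal H(X)$. Edge-pasting: given connected graphs $G_1=(V_1,E_1)$, $G_2=(V_2,E_2)$ and edges $a_1b_1\in E_1$, $a_2b_2\in E_2$, the graph obtained by edge-pasting is the graph obtained from the disjoint union of $G_1$ and $G_2$ by identifying $a_1$ with $a_2$, $b_1$ with $b_2$, and the edge $a_1b_1$ with the edge $a_2b_2$ (and making no other identifications). -}

module Defs where

open import Level using (Level; suc)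
open import Data.Bool using (Bool; true; false; _xor_)
open import Data.Bool.Properties using (xor-same; xor-comm)
open import Data.Empty using (⊥)
open import Data.List using (List; []; _∷_; [_]; length)
open import Data.List.Membership.Propositional using (_∈_)
open import Data.List.Relation.Unary.Any using (here)
import Data.List.Relation.Unary.Unique.Propositional as Propositional
import Data.List.Relation.Unary.Unique.Setoid as Unique
open import Data.Nat using (ℕ; _≤_) renaming (suc to 1+)
open import Data.Product using (Σ; ∃-syntax; Σ-syntax; _×_; _,_; proj₁)
open import Data.Sum using (_⊎_; inj₁; inj₂)
open import Data.Sum.Relation.Binary.Pointwise using (Pointwise; inj₁; inj₂)
open import Function.Bundles using (Func; _⇔_; mk⇔; module Equivalence)
open import Relation.Binary.Bundles using (Setoid)
open import Relation.Binary.Core using (Rel)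
open import Relation.Binary.Definitions
  using (Symmetric; Transitive; Reflexive; Irreflexive; _Respects₂_)
open import Relation.Binary.PropositionalEquality
  using (_≡_; _≗_; refl; sym; trans; cong)

private
  variable
    ℓ : Level

------------------------------------------------------------------------
-- Graphs

-- Simple undirected nonempty graphs.  The vertices form a setoid: this is
-- what allows vertices to be identified (edge-pasting), and finite subsets
-- with the same elements to count as one vertex (hypercubes).

record Graph (ℓ : Level) : Set (suc ℓ) where
  field
    vertices : Setoid ℓ ℓ

  open Setoid vertices public using (_≈_) renaming (Carrier to V)

  field
    _~_      : Rel V ℓ
    ~-sym    : Symmetric _~_
    ~-irrefl : Irreflexive _≈_ _~_
    ~-resp-≈ : _~_ Respects₂ _≈_
    nonempty : V

module _ (G : Graph ℓ) where
  open Graph G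

  data Walk : V → V → ℕ → Set ℓ where
    nil  : ∀ {u v} → u ≈ v → Walk u v 0
    cons : ∀ {u v w n} → u ~ v → Walk v w n → Walk u w (1+ n)

  -- Exactly one entry for each of the n + 1 vertices visited; in the nil
  -- case the two endpoints are the same vertex.
  visited : ∀ {u v n} → Walk u v n → List V
  visited (nil {u} _)    = [ u ]
  visited (cons {u} _ p) = u ∷ visited p

  Path : V → V → ℕ → Set ℓ
  Path u v n = Σ[ p ∈ Walk u v n ] Unique.Unique vertices (visited p)

  Connected : Set ℓ
  Connected = ∀ u v → ∃[ n ] Path u v n

  -- d(u , v) = n.  A relation rather than a function, since distances in an
  -- arbitrary graph need neither be finite nor computable.
  Distance : V → V → ℕ → Set ℓ
  Distance u v n = Path u v n × (∀ m → Path u v m → n ≤ m)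

-- Vertices at infinite distance are related by Distance to no n, so the
-- equivalence also preserves and reflects infinite distances.
IsIsometricEmbedding : (G H : Graph ℓ) →
                       Func (Graph.vertices G) (Graph.vertices H) → Set ℓ
IsIsometricEmbedding G H f =
  ∀ u v n → Distance G u v n ⇔ Distance H (Func.to f u) (Func.to f v) n

------------------------------------------------------------------------
-- Hypercubes

-- Subsets are given by characteristic functions, so that symmetric
-- differences can be formed without assuming that X has decidable equality.

Subset : Set ℓ → Set ℓ
Subset X = X → Bool

module _ {X : Set ℓ} where

  _Δ_ : Subset X → Subset X → Subset X
  (P Δ Q) x = P x xor Q x

  Finite : Subset X → Set ℓ
  Finite P = ∃[ xs ] (∀ x → P x ≡ true → x ∈ xs)

  HasCardinality : Subset X → ℕ → Set ℓ
  HasCardinality P n =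
    ∃[ xs ] Propositional.Unique xs × length xs ≡ n × (∀ x → P x ≡ true ⇔ x ∈ xs)

  HasCardinality-resp-≗ : ∀ {P Q n} → P ≗ Q → HasCardinality P n → HasCardinality Q n
  HasCardinality-resp-≗ P≗Q (xs , uniq , len , mem) =
    xs , uniq , len , λ x → mk⇔
      (λ Qx → Equivalence.to (mem x) (trans (P≗Q x) Qx))
      (λ x∈ → trans (sym (P≗Q x)) (Equivalence.from (mem x) x∈))

FiniteSubset : Set ℓ → Set ℓ
FiniteSubset X = Σ (Subset X) Finite

hypercube : Set ℓ → Graph ℓ
hypercube X = record
  { vertices = record
    { Carrier       = FiniteSubset X
    ; _≈_           = λ P Q → proj₁ P ≗ proj₁ Q
    ; isEquivalence = record
      { refl  = λ _ → refl
      ; sym   = λ P≗Q x → sym (P≗Q x)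
      ; trans = λ P≗Q Q≗R x → trans (P≗Q x) (Q≗R x)
      }
    }
  ; _~_      = λ P Q → HasCardinality (proj₁ P Δ proj₁ Q) 1
  ; ~-sym    = λ {P} {Q} →
      HasCardinality-resp-≗ (λ x → xor-comm (proj₁ P x) (proj₁ Q x))
  ; ~-irrefl = λ {P} {Q} → irrefl {P} {Q}
  ; ~-resp-≈ =
      (λ {P} Q≗R → HasCardinality-resp-≗ (λ x → cong (proj₁ P x xor_) (Q≗R x)))
    , (λ {P} Q≗R → HasCardinality-resp-≗ (λ x → cong (_xor proj₁ P x) (Q≗R x)))
  ; nonempty = (λ _ → false) , [] , λ _ ()
  }
  where
  irrefl : ∀ {P Q : FiniteSubset X} → proj₁ P ≗ proj₁ Q →
           HasCardinality (proj₁ P Δ proj₁ Q) 1 → ⊥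
  irrefl {P} {Q} P≗Q (x ∷ [] , _ , _ , mem)
    with () ← trans (sym (Equivalence.from (mem x) (here refl)))
                    (trans (cong (_xor proj₁ Q x) (P≗Q x)) (xor-same (proj₁ Q x)))

IsPartialCube : Graph ℓ → Set (suc ℓ)
IsPartialCube {ℓ} G =
  Σ[ X ∈ Set ℓ ]
  Σ[ f ∈ Func (Graph.vertices G) (Graph.vertices (hypercube X)) ]
    IsIsometricEmbedding G (hypercube X) f

------------------------------------------------------------------------
-- Edge-pasting

module EdgePasting
  (G₁ G₂ : Graph ℓ)
  {a₁ b₁ : Graph.V G₁} (a₁~b₁ : Graph._~_ G₁ a₁ b₁)
  {a₂ b₂ : Graph.V G₂} (a₂~b₂ : Graph._~_ G₂ a₂ b₂)
  where

  private
    module G₁ = Graph G₁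
    module G₂ = Graph G₂
    module V₁ = Setoid G₁.vertices
    module V₂ = Setoid G₂.vertices

  Glued : G₁.V → G₂.V → Set ℓ
  Glued x y = (x G₁.≈ a₁ × y G₂.≈ a₂) ⊎ (x G₁.≈ b₁ × y G₂.≈ b₂)

  infix 4 _≈ₚ_ _~ₚ_

  data _≈ₚ_ : Rel (G₁.V ⊎ G₂.V) ℓ where
    same₁  : ∀ {x y} → x G₁.≈ y → inj₁ x ≈ₚ inj₁ y
    same₂  : ∀ {x y} → x G₂.≈ y → inj₂ x ≈ₚ inj₂ y
    glue₁₂ : ∀ {x y} → Glued x y → inj₁ x ≈ₚ inj₂ y
    glue₂₁ : ∀ {x y} → Glued x y → inj₂ y ≈ₚ inj₁ x

  -- Pointwise G₁._~_ G₂._~_ is adjacency in the disjoint union; its image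
  -- under the identifications is adjacency in the pasted graph.
  _~ₚ_ : Rel (G₁.V ⊎ G₂.V) ℓ
  u ~ₚ v = ∃[ u′ ] ∃[ v′ ] u ≈ₚ u′ × Pointwise G₁._~_ G₂._~_ u′ v′ × v′ ≈ₚ v

  ≈ₚ-refl : Reflexive _≈ₚ_
  ≈ₚ-refl {inj₁ _} = same₁ V₁.refl
  ≈ₚ-refl {inj₂ _} = same₂ V₂.refl

  ≈ₚ-sym : Symmetric _≈ₚ_
  ≈ₚ-sym (same₁ p)  = same₁ (V₁.sym p)
  ≈ₚ-sym (same₂ p)  = same₂ (V₂.sym p)
  ≈ₚ-sym (glue₁₂ g) = glue₂₁ g
  ≈ₚ-sym (glue₂₁ g) = glue₁₂ g

  private
    a₁≉b₁ : a₁ G₁.≈ b₁ → ⊥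
    a₁≉b₁ p = G₁.~-irrefl p a₁~b₁

    a₂≉b₂ : a₂ G₂.≈ b₂ → ⊥
    a₂≉b₂ p = G₂.~-irrefl p a₂~b₂

    Glued-respˡ : ∀ {x x′ y} → x G₁.≈ x′ → Glued x y → Glued x′ y
    Glued-respˡ p (inj₁ (q , r)) = inj₁ (V₁.trans (V₁.sym p) q , r)
    Glued-respˡ p (inj₂ (q , r)) = inj₂ (V₁.trans (V₁.sym p) q , r)

    Glued-respʳ : ∀ {x y y′} → y G₂.≈ y′ → Glued x y → Glued x y′
    Glued-respʳ p (inj₁ (q , r)) = inj₁ (q , V₂.trans (V₂.sym p) r)
    Glued-respʳ p (inj₂ (q , r)) = inj₂ (q , V₂.trans (V₂.sym p) r)

    Glued-injˡ : ∀ {x x′ y} → Glued x y → Glued x′ y → x G₁.≈ x′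
    Glued-injˡ (inj₁ (p , _)) (inj₁ (q , _)) = V₁.trans p (V₁.sym q)
    Glued-injˡ (inj₂ (p , _)) (inj₂ (q , _)) = V₁.trans p (V₁.sym q)
    Glued-injˡ (inj₁ (_ , p)) (inj₂ (_ , q)) with () ← a₂≉b₂ (V₂.trans (V₂.sym p) q)
    Glued-injˡ (inj₂ (_ , p)) (inj₁ (_ , q)) with () ← a₂≉b₂ (V₂.trans (V₂.sym q) p)

    Glued-injʳ : ∀ {x y y′} → Glued x y → Glued x y′ → y G₂.≈ y′
    Glued-injʳ (inj₁ (_ , p)) (inj₁ (_ , q)) = V₂.trans p (V₂.sym q)
    Glued-injʳ (inj₂ (_ , p)) (inj₂ (_ , q)) = V₂.trans p (V₂.sym q)
    Glued-injʳ (inj₁ (p , _)) (inj₂ (q , _)) with () ← a₁≉b₁ (V₁.trans (V₁.sym p) q)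
    Glued-injʳ (inj₂ (p , _)) (inj₁ (q , _)) with () ← a₁≉b₁ (V₁.trans (V₁.sym q) p)

  ≈ₚ-trans : Transitive _≈ₚ_
  ≈ₚ-trans (same₁ p)  (same₁ q)  = same₁ (V₁.trans p q)
  ≈ₚ-trans (same₁ p)  (glue₁₂ g) = glue₁₂ (Glued-respˡ (V₁.sym p) g)
  ≈ₚ-trans (same₂ p)  (same₂ q)  = same₂ (V₂.trans p q)
  ≈ₚ-trans (same₂ p)  (glue₂₁ g) = glue₂₁ (Glued-respʳ (V₂.sym p) g)
  ≈ₚ-trans (glue₁₂ g) (same₂ q)  = glue₁₂ (Glued-respʳ q g)
  ≈ₚ-trans (glue₁₂ g) (glue₂₁ h) = same₁ (Glued-injˡ g h)
  ≈ₚ-trans (glue₂₁ g) (same₁ q)  = glue₂₁ (Glued-respˡ q g)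
  ≈ₚ-trans (glue₂₁ g) (glue₁₂ h) = same₂ (Glued-injʳ g h)

  ~ₚ-sym : Symmetric _~ₚ_
  ~ₚ-sym (u′ , v′ , p , inj₁ e , q) = v′ , u′ , ≈ₚ-sym q , inj₁ (G₁.~-sym e) , ≈ₚ-sym p
  ~ₚ-sym (u′ , v′ , p , inj₂ e , q) = v′ , u′ , ≈ₚ-sym q , inj₂ (G₂.~-sym e) , ≈ₚ-sym p

  ~ₚ-irrefl : Irreflexive _≈ₚ_ _~ₚ_
  ~ₚ-irrefl u≈v (u′ , v′ , p , e , q) =
    no-loop e (≈ₚ-trans (≈ₚ-sym p) (≈ₚ-trans u≈v (≈ₚ-sym q)))
    where
    no-loop : ∀ {u v} → Pointwise G₁._~_ G₂._~_ u v → u ≈ₚ v → ⊥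
    no-loop (inj₁ e) (same₁ p) = G₁.~-irrefl p e
    no-loop (inj₂ e) (same₂ p) = G₂.~-irrefl p e

  pasted : Graph ℓ
  pasted = record
    { vertices = record
      { Carrier       = G₁.V ⊎ G₂.V
      ; _≈_           = _≈ₚ_
      ; isEquivalence = record { refl = ≈ₚ-refl ; sym = ≈ₚ-sym ; trans = ≈ₚ-trans }
      }
    ; _~_      = _~ₚ_
    ; ~-sym    = ~ₚ-sym
    ; ~-irrefl = ~ₚ-irrefl
    ; ~-resp-≈ =
        (λ p (u′ , v′ , q , e , r) → u′ , v′ , q , e , ≈ₚ-trans r p)
      , (λ p (u′ , v′ , q , e , r) → u′ , v′ , ≈ₚ-trans (≈ₚ-sym p) q , e , r)
    ; nonempty = inj₁ G₁.nonempty
    }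

edgePasting : (G₁ G₂ : Graph ℓ)
              {a₁ b₁ : Graph.V G₁} → Graph._~_ G₁ a₁ b₁ →
              {a₂ b₂ : Graph.V G₂} → Graph._~_ G₂ a₂ b₂ → Graph ℓ
edgePasting G₁ G₂ e₁ e₂ = EdgePasting.pasted G₁ G₂ e₁ e₂

{-# OPTIONS --safe #-}

-- A connected graph is a partial cube exactly when its vertices can be labelled by
-- finite sets so that adjacent labels differ in one element and any two vertices
-- are joined by a walk whose length is the number of elements in which their labels
-- differ.  Translate the labels of both graphs so that a₁ and a₂ are labelled ∅;
-- then b₁ and b₂ are labelled by singletons {x₁} and {x₂}, and identifying x₁ with
-- x₂ makes the labellings agree on the pasted edge.  If u is in G₁ and v in G₂, let
-- c be the end of the edge that agrees with u at x₁: the labels of u and c,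
-- respectively of c and v, then differ in disjoint sets, so going through c gives a
-- walk of the required length.
module Submission where

open import Defs
open import Level using (Level)

open import Data.Bool using (true; false; _xor_; not)
import Data.Bool as Bool
open import Data.Bool.Properties using (xor-same; xor-comm; not-involutive; ¬-not)
open import Data.Empty using (⊥; ⊥-elim)
open import Data.Fin using (zero; suc)
open import Data.Fin.Properties using (injective⇒≤)
open import Data.List using (List; []; _∷_; _++_; length; lookup; map; filter)
open import Data.List.Membership.Propositional using (_∈_)
open import Data.List.Membership.Propositional.Properties
  using (∈-++⁺ˡ; ∈-++⁺ʳ; ∈-++⁻; ∈-map⁺; ∈-map⁻; ∈-filter⁺; ∈-filter⁻; ∈-lookup)
open import Data.List.Membership.Setoid.Properties using (index-injective)
open import Data.List.Properties using (length-++; length-map)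
open import Data.List.Relation.Unary.All using (All; []; _∷_)
import Data.List.Relation.Unary.All as All
open import Data.List.Relation.Unary.AllPairs using ([]; _∷_)
open import Data.List.Relation.Unary.Any using (here; there; index)
open import Data.List.Relation.Unary.Unique.Propositional using (Unique)
import Data.List.Relation.Unary.Unique.Propositional.Properties as Unique
import Data.List.Relation.Unary.Unique.Setoid as UniqueSetoid
open import Data.Nat using (ℕ; zero; suc; _+_; _≤_; z≤n; s≤s; s≤s⁻¹)
open import Data.Nat.Properties using (≤-refl; ≤-antisym; suc-injective; m≤n⇒m≤1+n; <⇒≱)
open import Data.Product using (Σ-syntax; ∃-syntax; _×_; _,_; proj₁; proj₂)
open import Data.Sum using (_⊎_; inj₁; inj₂)
open import Data.Sum.Properties using (inj₁-injective; inj₂-injective)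
import Data.Sum.Relation.Binary.Pointwise as Pointwise
open import Function.Base using (_∘_)
open import Function.Bundles using (Func; _⇔_; mk⇔; module Equivalence)
open import Function.Definitions using (Injective)
open import Relation.Binary.Bundles using (Setoid)
open import Relation.Binary.PropositionalEquality
  using (_≡_; _≢_; _≗_; refl; sym; trans; cong; cong₂; subst; setoid)
open import Relation.Nullary using (Dec; yes; no; does; contradiction)

open Equivalence using (to; from)

private
  variable
    ℓ : Level
    X : Set ℓ

-- Walks

module _ (G : Graph ℓ) where
  open Graph G
  private module V = Setoid vertices

  -- Minimality ranges over all walks, not only paths: walks can be mapped and joined without
  -- checking for repeated vertices, and `shortest⇒unique` recovers a path.
  Shortest : V → V → ℕ → Set ℓ
  Shortest u v n = ∀ m → Walk G u v m → n ≤ m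

  Walk-respˡ : ∀ {u u′ v n} → u ≈ u′ → Walk G u v n → Walk G u′ v n
  Walk-respˡ u≈u′ (nil u≈v)  = nil (V.trans (V.sym u≈u′) u≈v)
  Walk-respˡ u≈u′ (cons e p) = cons (proj₂ ~-resp-≈ u≈u′ e) p

  Walk-trans : ∀ {u v w m n} → Walk G u v m → Walk G v w n → Walk G u w (m + n)
  Walk-trans (nil u≈v)  q = Walk-respˡ (V.sym u≈v) q
  Walk-trans (cons e p) q = cons e (Walk-trans p q)

  Walk-snoc : ∀ {u v w n} → Walk G u v n → v ~ w → Walk G u w (suc n)
  Walk-snoc (nil u≈v)  f = cons (proj₂ ~-resp-≈ (V.sym u≈v) f) (nil V.refl)
  Walk-snoc (cons e p) f = cons e (Walk-snoc p f)

  Walk-sym : ∀ {u v n} → Walk G u v n → Walk G v u n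
  Walk-sym (nil u≈v)  = nil (V.sym u≈v)
  Walk-sym (cons e p) = Walk-snoc (Walk-sym p) (~-sym e)

  visited-suffix : ∀ {u v n} (p : Walk G u v n) →
                   All (λ w → ∃[ k ] k ≤ n × Walk G w v k) (visited G p)
  visited-suffix p@(nil _)    = (_ , ≤-refl , p) ∷ []
  visited-suffix p@(cons _ q) =
    (_ , ≤-refl , p) ∷
    All.map (λ (k , k≤n , r) → k , m≤n⇒m≤1+n k≤n , r) (visited-suffix q)

  -- If the first vertex recurred later, the suffix from that occurrence would be a strictly shorter
  -- walk between the same ends.
  shortest⇒unique : ∀ {u v n} (p : Walk G u v n) → Shortest u v n →
                    UniqueSetoid.Unique vertices (visited G p)
  shortest⇒unique (nil _)    _   = [] ∷ []
  shortest⇒unique (cons e p) min =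
    All.map (λ (k , k≤n , q) u≈w → <⇒≱ (s≤s k≤n) (min k (Walk-respˡ (V.sym u≈w) q)))
            (visited-suffix p)
    ∷ shortest⇒unique p (λ m q → s≤s⁻¹ (min (suc m) (cons e q)))

  shortest⇒distance : ∀ {u v n} → Walk G u v n → Shortest u v n → Distance G u v n
  shortest⇒distance p min = (p , shortest⇒unique p min) , λ m q → min m (proj₁ q)

  distance-unique : ∀ {u v m n} → Distance G u v m → Distance G u v n → m ≡ n
  distance-unique (p , p-min) (q , q-min) = ≤-antisym (p-min _ q) (q-min _ p)

  edge⇒distance : ∀ {u v} → u ~ v → Distance G u v 1
  edge⇒distance e = shortest⇒distance (cons e (nil V.refl))
    λ { zero    (nil u≈v) → ⊥-elim (~-irrefl u≈v e)
      ; (suc _) _         → s≤s z≤n }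

Walk-map : (G H : Graph ℓ) (f : Graph.V G → Graph.V H) →
           (∀ {u v} → Graph._≈_ G u v → Graph._≈_ H (f u) (f v)) →
           (∀ {u v} → Graph._~_ G u v → Graph._~_ H (f u) (f v)) →
           ∀ {u v n} → Walk G u v n → Walk H (f u) (f v) n
Walk-map G H f f-≈ f-~ (nil p)    = nil (f-≈ p)
Walk-map G H f f-≈ f-~ (cons e p) = cons (f-~ e) (Walk-map G H f f-≈ f-~ p)

-- Symmetric differences and cardinalities

xor-telescope : ∀ b c d → (b xor c) xor (c xor d) ≡ b xor d
xor-telescope false false d = refl
xor-telescope false true  d = not-involutive d
xor-telescope true  false d = refl
xor-telescope true  true  d = refl

-- Translating two sets by a common third preserves their symmetric difference; this lets labels be
-- normalised to be empty at `a₁` and `a₂`.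
xor-translate : ∀ b c d → (b xor d) xor (c xor d) ≡ b xor c
xor-translate b c d =
  trans (cong ((b xor d) xor_) (xor-comm c d)) (xor-telescope b d c)

xor-true⁻ : ∀ b c → b xor c ≡ true → b ≡ true ⊎ c ≡ true
xor-true⁻ true  _ _ = inj₁ refl
xor-true⁻ false _ p = inj₂ p

xor≡false⇒≡ : ∀ b c → b xor c ≡ false → b ≡ c
xor≡false⇒≡ true  true  _ = refl
xor≡false⇒≡ false false _ = refl

∅-cardinality : {P : Subset X} → (∀ x → P x ≡ false) → HasCardinality P 0
∅-cardinality P≗∅ = [] , [] , refl ,
  λ x → mk⇔ (λ Px → contradiction (trans (sym Px) (P≗∅ x)) λ ()) λ ()

-- Filtering the enumeration of `Q` by the Boolean predicate `P` keeps it duplicate-free, so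
-- equality in `X` need not be decided.
⊆-cardinality : {P Q : Subset X} {n : ℕ} → (∀ x → P x ≡ true → Q x ≡ true) →
                HasCardinality Q n → ∃[ m ] HasCardinality P m
⊆-cardinality {P = P} P⊆Q (xs , uniq , _ , mem) =
  _ , filter P? xs , Unique.filter⁺ P? uniq , refl , λ x → mk⇔
    (λ Px → ∈-filter⁺ P? (to (mem x) (P⊆Q x Px)) Px)
    (λ x∈ → proj₂ (∈-filter⁻ P? {xs = xs} x∈))
  where P? = λ x → P x Bool.≟ true

disjoint-cardinality : {P Q : Subset X} {m n : ℕ} →
                       (∀ x → P x ≡ true → Q x ≡ true → ⊥) →
                       HasCardinality P m → HasCardinality Q n →
                       HasCardinality (P Δ Q) (m + n)
disjoint-cardinality {P = P} {Q} disj (xs , uxs , refl , memP) (ys , uys , refl , memQ) =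
  xs ++ ys
  , Unique.++⁺ uxs uys (λ (x∈xs , x∈ys) → disj _ (from (memP _) x∈xs) (from (memQ _) x∈ys))
  , length-++ xs
  , λ x → mk⇔ (into x) (onto x ∘ ∈-++⁻ xs)
  where
  into : ∀ x → (P Δ Q) x ≡ true → x ∈ xs ++ ys
  into x p with xor-true⁻ (P x) (Q x) p
  ... | inj₁ Px = ∈-++⁺ˡ (to (memP x) Px)
  ... | inj₂ Qx = ∈-++⁺ʳ xs (to (memQ x) Qx)

  onto : ∀ x → x ∈ xs ⊎ x ∈ ys → (P Δ Q) x ≡ true
  onto x (inj₁ x∈) with P x in Px | Q x in Qx | from (memP x) x∈
  ... | true | false | _ = refl
  ... | true | true  | _ = ⊥-elim (disj x Px Qx)
  onto x (inj₂ x∈) with P x in Px | Q x in Qx | from (memQ x) x∈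
  ... | false | true | _ = refl
  ... | true  | true | _ = ⊥-elim (disj x Px Qx)

-- X need not have decidable equality, but a listed element of a set with a
-- characteristic function can be told apart from everything else.
head≟ : {P : Subset X} {x : X} {xs : List X} → Unique (x ∷ xs) →
        (∀ y → P y ≡ true ⇔ y ∈ x ∷ xs) → ∀ y → Dec (x ≡ y)
head≟ {P = P} (x∉xs ∷ _) mem y with P y in Py
... | false = no λ { refl → contradiction (trans (sym Py) (from (mem y) (here refl))) λ () }
... | true with to (mem y) Py
...   | here y≡x   = yes (sym y≡x)
...   | there y∈xs = no (All.lookup x∉xs y∈xs)

singleton : {x : X} → (∀ y → Dec (x ≡ y)) → Subset X
singleton x≟ y = does (x≟ y)

singleton-cardinality : {x : X} (x≟ : ∀ y → Dec (x ≡ y)) → HasCardinality (singleton x≟) 1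
singleton-cardinality {x = x} x≟ = x ∷ [] , [] ∷ [] , refl , λ y → mk⇔ (into y) (onto y)
  where
  into : ∀ y → singleton x≟ y ≡ true → y ∈ x ∷ []
  into y _ with yes refl ← x≟ y = here refl

  onto : ∀ y → y ∈ x ∷ [] → singleton x≟ y ≡ true
  onto y (here refl) with x≟ y
  ... | yes _  = refl
  ... | no x≢x = contradiction refl x≢x

unique-lookup-injective : {xs : List X} → Unique xs → Injective _≡_ _≡_ (lookup xs)
unique-lookup-injective (_ ∷ _)    {zero}  {zero}  _  = refl
unique-lookup-injective (x∉xs ∷ _) {zero}  {suc j} eq =
  contradiction eq (All.lookup x∉xs (∈-lookup j))
unique-lookup-injective (x∉xs ∷ _) {suc i} {zero}  eq =
  contradiction (sym eq) (All.lookup x∉xs (∈-lookup i))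
unique-lookup-injective (_ ∷ uniq) {suc i} {suc j} eq = cong suc (unique-lookup-injective uniq eq)

-- Pigeonhole on positions: sending each position of `xs` to the position of its entry in `ys` is
-- injective.
unique-⊆⇒length≤ : {xs ys : List X} → Unique xs → (∀ {x} → x ∈ xs → x ∈ ys) →
                   length xs ≤ length ys
unique-⊆⇒length≤ {X = X} uniq xs⊆ys =
  injective⇒≤ {f = λ i → index (xs⊆ys (∈-lookup i))} λ eq →
    unique-lookup-injective uniq
      (index-injective (setoid X) (xs⊆ys (∈-lookup _)) (xs⊆ys (∈-lookup _)) eq)

-- Distances in hypercubes

_Δᶠ_ : FiniteSubset X → FiniteSubset X → FiniteSubset X
(P , xs , P⊆xs) Δᶠ (Q , ys , Q⊆ys) = P Δ Q , xs ++ ys , λ x p → split x (xor-true⁻ (P x) (Q x) p)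
  where
  split : ∀ x → P x ≡ true ⊎ Q x ≡ true → x ∈ xs ++ ys
  split x (inj₁ Px) = ∈-++⁺ˡ (P⊆xs x Px)
  split x (inj₂ Qx) = ∈-++⁺ʳ xs (Q⊆ys x Qx)

-- `zs` records the one element flipped at each step; an element on which the ends differ must have
-- been flipped somewhere. This bounds walk lengths from below.
walk-flips : ∀ {P Q : FiniteSubset X} {n} → Walk (hypercube X) P Q n →
             ∃[ zs ] length zs ≡ n × (∀ x → (proj₁ P Δ proj₁ Q) x ≡ true → x ∈ zs)
walk-flips {Q = Q , _} (nil P≗Q) = [] , refl , λ x p →
  contradiction (trans (sym p) (trans (cong (_xor Q x) (P≗Q x)) (xor-same (Q x)))) λ ()
walk-flips {P = P , _} {Q = Q , _} (cons {v = R , _} (z ∷ [] , _ , refl , mem) p)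
  with zs , len , flips ← walk-flips p =
  z ∷ zs , cong suc len , λ x PΔQ →
    split x (xor-true⁻ ((P Δ R) x) ((R Δ Q) x) (trans (xor-telescope (P x) (R x) (Q x)) PΔQ))
  where
  split : ∀ x → (P Δ R) x ≡ true ⊎ (R Δ Q) x ≡ true → x ∈ z ∷ _
  split x (inj₁ PΔR) with here x≡z ← to (mem x) PΔR = here x≡z
  split x (inj₂ RΔQ) = there (flips x RΔQ)

cardinality⇒shortest : ∀ {P Q : FiniteSubset X} {n} → HasCardinality (proj₁ P Δ proj₁ Q) n →
                       Shortest (hypercube X) P Q n
cardinality⇒shortest (xs , uniq , refl , mem) m p with zs , refl , flips ← walk-flips p =
  unique-⊆⇒length≤ uniq (λ {x} x∈xs → flips x (from (mem x) x∈xs))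

-- The walk flips the listed elements one at a time: `Rᶠ` is `P` with the head `x` flipped, and
-- since `x` does not recur in `xs`, the tail enumerates what is still to be flipped.
cardinality⇒walk : ∀ (P Q : FiniteSubset X) n → HasCardinality (proj₁ P Δ proj₁ Q) n →
                   Walk (hypercube X) P Q n
cardinality⇒walk (P , _) (Q , _) zero ([] , _ , _ , mem) =
  nil λ x → xor≡false⇒≡ (P x) (Q x) (¬-not λ PΔQ → contradiction (to (mem x) PΔQ) λ ())
cardinality⇒walk {X = X} Pᶠ@(P , _) Qᶠ@(Q , _) (suc n)
                 (x ∷ xs , uniq@(x∉xs ∷ uniq′) , len , mem) =
  cons {v = Rᶠ}
    (HasCardinality-resp-≗ (λ y → flip (P y) (singleton x≟ y)) (singleton-cardinality x≟))
    (cardinality⇒walk Rᶠ Qᶠ n (xs , uniq′ , suc-injective len , λ y → mk⇔ (into y) (onto y)))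
  where
  x≟ : ∀ y → Dec (x ≡ y)
  x≟ = head≟ uniq mem

  Rᶠ : FiniteSubset X
  Rᶠ = Pᶠ Δᶠ (singleton x≟ , x ∷ [] ,
              λ y → to (proj₂ (proj₂ (proj₂ (singleton-cardinality x≟))) y))

  flip : ∀ b c → c ≡ b xor (b xor c)
  flip false _ = refl
  flip true  c = sym (not-involutive c)

  swap : ∀ b c d → (b xor c) xor d ≡ c xor (b xor d)
  swap false c     d = refl
  swap true  false d = refl
  swap true  true  d = sym (not-involutive d)

  into : ∀ y → ((P Δ singleton x≟) Δ Q) y ≡ true → y ∈ xs
  -- With the singleton moved to the front, the outcome of `x≟ y` makes the difference compute:
  -- `P Δ Q` negated at `x`, unchanged elsewhere.
  into y p with x≟ y | trans (sym (swap (P y) (singleton x≟ y) (Q y))) p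
  ... | yes refl | ¬PΔQ =
    contradiction (trans (sym ¬PΔQ) (cong not (from (mem x) (here refl)))) λ ()
  ... | no x≢y   | PΔQ with to (mem y) PΔQ
  ...   | here y≡x   = contradiction (sym y≡x) x≢y
  ...   | there y∈xs = y∈xs

  onto : ∀ y → y ∈ xs → ((P Δ singleton x≟) Δ Q) y ≡ true
  onto y y∈xs with x≟ y | swap (P y) (singleton x≟ y) (Q y)
  ... | yes refl | _  = contradiction refl (All.lookup x∉xs y∈xs)
  ... | no _     | eq = trans eq (from (mem y) (there y∈xs))

cardinality⇒distance : ∀ {P Q : FiniteSubset X} {n} → HasCardinality (proj₁ P Δ proj₁ Q) n →
                       Distance (hypercube X) P Q n
cardinality⇒distance {X = X} {P} {Q} card =
  shortest⇒distance (hypercube X) (cardinality⇒walk P Q _ card)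
    (cardinality⇒shortest {P = P} {Q = Q} card)

-- The list in a `FiniteSubset` may contain repetitions and non-members, so it gives no cardinality
-- by itself; a walk, of whatever length, allows the difference to be counted step by step.
walk⇒cardinality : ∀ {P Q : FiniteSubset X} {n} → Walk (hypercube X) P Q n →
                   ∃[ k ] HasCardinality (proj₁ P Δ proj₁ Q) k
walk⇒cardinality {Q = Q , _} (nil P≗Q) =
  0 , ∅-cardinality λ x → trans (cong (_xor Q x) (P≗Q x)) (xor-same (Q x))
walk⇒cardinality {P = P , _} {Q = Q , _} (cons {v = R , _} step@(z ∷ [] , _ , refl , mem) p)
  with k , card ← walk⇒cardinality p | (R Δ Q) z in RΔQz
-- The flipped element `z` is not flipped back on the rest of the walk, so it adds one new element.
... | false = suc k , HasCardinality-resp-≗ (λ x → xor-telescope (P x) (R x) (Q x))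
                        (disjoint-cardinality disj step card)
  where
  disj : ∀ x → (P Δ R) x ≡ true → (R Δ Q) x ≡ true → ⊥
  disj x PΔR RΔQ with here refl ← to (mem x) PΔR = contradiction (trans (sym RΔQz) RΔQ) λ ()
-- Here `z` cancels, so `P Δ Q` lies inside the difference already counted.
... | true = ⊆-cardinality sub card
  where
  sub : ∀ x → (P Δ Q) x ≡ true → (R Δ Q) x ≡ true
  sub x PΔQ with xor-true⁻ ((P Δ R) x) ((R Δ Q) x) (trans (xor-telescope (P x) (R x) (Q x)) PΔQ)
  ... | inj₂ RΔQ = RΔQ
  ... | inj₁ PΔR with here refl ← to (mem x) PΔR = RΔQz

-- Labellings

record Labelling (G : Graph ℓ) (X : Set ℓ) : Set ℓ where
  open Graph G
  field
    label      : V → FiniteSubset X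
    label-cong : ∀ {u v} → u ≈ v → proj₁ (label u) ≗ proj₁ (label v)

  diff : V → V → Subset X
  diff u v = proj₁ (label u) Δ proj₁ (label v)

  field
    edge     : ∀ {u v} → u ~ v → HasCardinality (diff u v) 1
    geodesic : ∀ u v → ∃[ n ] Walk G u v n × HasCardinality (diff u v) n

-- Labels carry every walk of `G` to a hypercube walk of the same length, which is at least the
-- cardinality of the difference. So the walk from `geodesic` is shortest, both distances equal `k`,
-- and uniqueness of distances gives the equivalence.
labelling⇒partialCube : (G : Graph ℓ) → Labelling G X → IsPartialCube G
labelling⇒partialCube {X = X} G L =
  X , record { to = label ; cong = label-cong } , λ u v n →
    let k , p , card = geodesic u v
        min m q      = cardinality⇒shortest {P = label u} {Q = label v} card m
                         (Walk-map G (hypercube X) label label-cong edge q)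
        dG           = shortest⇒distance G p min
        dH           = cardinality⇒distance {P = label u} {Q = label v} card
    in mk⇔
      (λ d → subst (Distance (hypercube X) _ _) (distance-unique G dG d) dH)
      (λ d → subst (Distance G _ _) (distance-unique (hypercube X) dH d) dG)
  where open Labelling L

-- Connectedness provides some walk; its image makes the label difference countable, say of size
-- `k`. The hypercube distance is then `k`, and the isometry reflects it to a walk of length `k` in
-- `G`.
partialCube⇒labelling : (G : Graph ℓ) → Connected G → IsPartialCube G →
                        Σ[ X ∈ Set ℓ ] Labelling G X
partialCube⇒labelling G conn (X , f , iso) = X , record
  { label      = Func.to f
  ; label-cong = Func.cong f
  ; edge       = edge
  ; geodesic   = λ u v →
      let _ , p , _ = conn u v
          k , card  = walk⇒cardinality (Walk-map G (hypercube X) (Func.to f) (Func.cong f) edge p)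
          (q , _) , _ = from (iso u v k)
                          (cardinality⇒distance {P = Func.to f u} {Q = Func.to f v} card)
      in k , q , card
  }
  where
  edge : ∀ {u v} → Graph._~_ G u v → HasCardinality (proj₁ (Func.to f u) Δ proj₁ (Func.to f v)) 1
  -- A hypercube path of length 1 is one step followed by `nil`, whose ends agree only pointwise;
  -- the step is transported along that agreement.
  edge {u} {v} e with ((cons {v = R} step (nil R≗Q)) , _) , _ ← to (iso u v 1) (edge⇒distance G e) =
    proj₁ (Graph.~-resp-≈ (hypercube X)) {Func.to f u} {R} {Func.to f v} R≗Q step

-- Images of subsets

-- Subsets are Boolean-valued, so forming an image requires deciding membership in the range of `i`.
module Image {A B : Set ℓ} (i : A → B) (i-injective : Injective _≡_ _≡_ i)
             (i⁻¹? : ∀ b → Dec (∃[ a ] i a ≡ b)) where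

  image : Subset A → Subset B
  image P b with i⁻¹? b
  ... | yes (a , _) = P a
  ... | no _        = false

  image-∈⁻ : ∀ P b → image P b ≡ true → ∃[ a ] i a ≡ b × P a ≡ true
  image-∈⁻ P b p with yes (a , ia≡b) ← i⁻¹? b = a , ia≡b , p

  image-∈⁺ : ∀ P {a} → P a ≡ true → image P (i a) ≡ true
  image-∈⁺ P {a} p with i⁻¹? (i a)
  ... | yes (a′ , ia′≡ia) = trans (cong P (i-injective ia′≡ia)) p
  ... | no ∄a             = contradiction (a , refl) ∄a

  image-cong : ∀ {P Q} → P ≗ Q → image P ≗ image Q
  image-cong P≗Q b with i⁻¹? b
  ... | yes (a , _) = P≗Q a
  ... | no _        = refl

  image-Δ : ∀ P Q → image P Δ image Q ≗ image (P Δ Q)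
  image-Δ P Q b with i⁻¹? b
  ... | yes _ = refl
  ... | no _  = refl

  imageᶠ : FiniteSubset A → FiniteSubset B
  imageᶠ (P , xs , P⊆xs) = image P , map i xs , finite
    where
    finite : ∀ b → image P b ≡ true → b ∈ map i xs
    finite b p with a , refl , Pa ← image-∈⁻ P b p = ∈-map⁺ i (P⊆xs a Pa)

  image-cardinality : ∀ {P n} → HasCardinality P n → HasCardinality (image P) n
  image-cardinality {P} (xs , uniq , refl , mem) =
    map i xs , Unique.map⁺ i-injective uniq , length-map i xs , λ b → mk⇔ (into b) (onto b)
    where
    into : ∀ b → image P b ≡ true → b ∈ map i xs
    into b p with a , refl , Pa ← image-∈⁻ P b p = ∈-map⁺ i (to (mem a) Pa)

    onto : ∀ b → b ∈ map i xs → image P b ≡ true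
    onto b b∈ with a , a∈ , refl ← ∈-map⁻ i b∈ = image-∈⁺ P (from (mem a) a∈)

-- The disjoint union of A and B with x and y identified: y represents both, and
-- inj₁ x is a junk element, outside the images of left and inj₂.
module Identify {A B : Set ℓ} {x : A} (x≟ : ∀ a → Dec (x ≡ a)) (y : B) where

  left : A → A ⊎ B
  left a with x≟ a
  ... | yes _ = inj₂ y
  ... | no _  = inj₁ a

  left-x : left x ≡ inj₂ y
  left-x with x≟ x
  ... | yes _  = refl
  ... | no x≢x = contradiction refl x≢x

  left≡inj₁⁻ : ∀ {a a′} → left a ≡ inj₁ a′ → x ≢ a × a ≡ a′
  left≡inj₁⁻ {a} eq with no x≢a ← x≟ a = x≢a , inj₁-injective eq

  left≡inj₂⁻ : ∀ {a b} → left a ≡ inj₂ b → x ≡ a × y ≡ b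
  left≡inj₂⁻ {a} eq with yes x≡a ← x≟ a = x≡a , inj₂-injective eq

  left-injective : Injective _≡_ _≡_ left
  left-injective {a} {a′} eq with left a′ in eq′
  ... | inj₁ _ = trans (proj₂ (left≡inj₁⁻ eq)) (sym (proj₂ (left≡inj₁⁻ eq′)))
  ... | inj₂ _ = trans (sym (proj₁ (left≡inj₂⁻ eq))) (proj₁ (left≡inj₂⁻ eq′))

  left⁻¹? : (y≟ : ∀ b → Dec (y ≡ b)) → ∀ c → Dec (∃[ a ] left a ≡ c)
  -- The shape of `left a` tells whether `a` is `x`; if it is, `inj₁ a` is the junk element and has
  -- no preimage.
  left⁻¹? y≟ (inj₁ a) with left a in eq
  ... | inj₁ _ = yes (a , trans eq (cong inj₁ (sym (proj₂ (left≡inj₁⁻ eq)))))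
  ... | inj₂ _ = no λ (a′ , eq′) → let x≢a′ , a′≡a = left≡inj₁⁻ eq′ in
                   x≢a′ (trans (proj₁ (left≡inj₂⁻ eq)) (sym a′≡a))
  left⁻¹? y≟ (inj₂ b) with y≟ b
  ... | yes refl = yes (x , left-x)
  ... | no y≢b   = no λ (_ , eq) → y≢b (proj₂ (left≡inj₂⁻ eq))

  inj₂⁻¹? : ∀ (c : A ⊎ B) → Dec (∃[ b ] inj₂ b ≡ c)
  inj₂⁻¹? (inj₁ _) = no λ ()
  inj₂⁻¹? (inj₂ b) = yes (b , refl)

-- Labelling the pasted graph

module _ (G₁ G₂ : Graph ℓ)
  {a₁ b₁ : Graph.V G₁} (a₁~b₁ : Graph._~_ G₁ a₁ b₁)
  {a₂ b₂ : Graph.V G₂} (a₂~b₂ : Graph._~_ G₂ a₂ b₂)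
  {X₁ X₂ : Set ℓ} (L₁ : Labelling G₁ X₁) (L₂ : Labelling G₂ X₂)
  where

  open EdgePasting G₁ G₂ a₁~b₁ a₂~b₂
  private
    module G₁ = Graph G₁
    module G₂ = Graph G₂
    module L₁ = Labelling L₁
    module L₂ = Labelling L₂

  pasted-labelling : Labelling pasted (X₁ ⊎ X₂)
  pasted-labelling with L₁.edge a₁~b₁ | L₂.edge a₂~b₂
  -- The one-element enumerations for the pasted edges supply the elements to identify and, through
  -- `head≟`, the means to decide equality with each.
  ... | x₁ ∷ [] , uniq₁ , refl , mem₁ | x₂ ∷ [] , uniq₂ , refl , mem₂ = record
    { label      = label
    ; label-cong = label-cong
    ; edge       = edge
    ; geodesic   = geodesic
    }
    where
    open Identify (head≟ uniq₁ mem₁) x₂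
    module I₁ = Image left left-injective (left⁻¹? (head≟ uniq₂ mem₂))
    module I₂ = Image (inj₂ {A = X₁} {B = X₂}) inj₂-injective inj₂⁻¹?

    label : G₁.V ⊎ G₂.V → FiniteSubset (X₁ ⊎ X₂)
    label (inj₁ u) = I₁.imageᶠ (L₁.label u Δᶠ L₁.label a₁)
    label (inj₂ v) = I₂.imageᶠ (L₂.label v Δᶠ L₂.label a₂)

    diff : (u v : G₁.V ⊎ G₂.V) → Subset (X₁ ⊎ X₂)
    diff u v = proj₁ (label u) Δ proj₁ (label v)

    image-∅₁ : ∀ w → I₁.image (L₁.diff a₁ a₁) w ≡ false
    image-∅₁ w = ¬-not λ p → let x , _ , q = I₁.image-∈⁻ (L₁.diff a₁ a₁) w p in
      contradiction (trans (sym q) (xor-same (proj₁ (L₁.label a₁) x))) λ ()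

    image-∅₂ : ∀ w → I₂.image (L₂.diff a₂ a₂) w ≡ false
    image-∅₂ w = ¬-not λ p → let x , _ , q = I₂.image-∈⁻ (L₂.diff a₂ a₂) w p in
      contradiction (trans (sym q) (xor-same (proj₁ (L₂.label a₂) x))) λ ()

    -- This image and the one in `image-ba₂⇔` are the labels of `b₁` and `b₂`. As `left` sends `x₁`
    -- to `inj₂ x₂`, one predicate describes both, and `true⇔⇒≡` equates them.
    image-ba₁⇔ : ∀ w → I₁.image (L₁.diff b₁ a₁) w ≡ true ⇔ w ≡ inj₂ x₂
    image-ba₁⇔ w = mk⇔ into λ { refl → onto }
      where
      swap : ∀ x → L₁.diff b₁ a₁ x ≡ L₁.diff a₁ b₁ x
      swap x = xor-comm (proj₁ (L₁.label b₁) x) (proj₁ (L₁.label a₁) x)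

      into : I₁.image (L₁.diff b₁ a₁) w ≡ true → w ≡ inj₂ x₂
      into p with x , refl , q ← I₁.image-∈⁻ (L₁.diff b₁ a₁) w p
        with here refl ← to (mem₁ x) (trans (sym (swap x)) q) = left-x

      onto : I₁.image (L₁.diff b₁ a₁) (inj₂ x₂) ≡ true
      onto = subst (λ w → I₁.image (L₁.diff b₁ a₁) w ≡ true) left-x
        (I₁.image-∈⁺ (L₁.diff b₁ a₁) (trans (swap x₁) (from (mem₁ x₁) (here refl))))

    image-ba₂⇔ : ∀ w → I₂.image (L₂.diff b₂ a₂) w ≡ true ⇔ w ≡ inj₂ x₂
    image-ba₂⇔ w = mk⇔ into λ { refl → onto }
      where
      swap : ∀ x → L₂.diff b₂ a₂ x ≡ L₂.diff a₂ b₂ x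
      swap x = xor-comm (proj₁ (L₂.label b₂) x) (proj₁ (L₂.label a₂) x)

      into : I₂.image (L₂.diff b₂ a₂) w ≡ true → w ≡ inj₂ x₂
      into p with x , refl , q ← I₂.image-∈⁻ (L₂.diff b₂ a₂) w p
        with here refl ← to (mem₂ x) (trans (sym (swap x)) q) = refl

      onto : I₂.image (L₂.diff b₂ a₂) (inj₂ x₂) ≡ true
      onto = I₂.image-∈⁺ (L₂.diff b₂ a₂) (trans (swap x₂) (from (mem₂ x₂) (here refl)))

    true⇔⇒≡ : ∀ {b c} {P : Set ℓ} → b ≡ true ⇔ P → c ≡ true ⇔ P → b ≡ c
    true⇔⇒≡ {true}  {_}     p q = sym (from q (to p refl))
    true⇔⇒≡ {false} {true}  p q = from p (to q refl)
    true⇔⇒≡ {false} {false} p q = refl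

    label-cong₁ : ∀ {u v} → u G₁.≈ v → proj₁ (label (inj₁ u)) ≗ proj₁ (label (inj₁ v))
    label-cong₁ u≈v = I₁.image-cong λ x → cong (_xor proj₁ (L₁.label a₁) x) (L₁.label-cong u≈v x)

    label-cong₂ : ∀ {u v} → u G₂.≈ v → proj₁ (label (inj₂ u)) ≗ proj₁ (label (inj₂ v))
    label-cong₂ u≈v = I₂.image-cong λ x → cong (_xor proj₁ (L₂.label a₂) x) (L₂.label-cong u≈v x)

    label-glued : ∀ {u v} → Glued u v → proj₁ (label (inj₁ u)) ≗ proj₁ (label (inj₂ v))
    label-glued (inj₁ (u≈a₁ , v≈a₂)) w =
      trans (label-cong₁ u≈a₁ w)
        (trans (trans (image-∅₁ w) (sym (image-∅₂ w))) (sym (label-cong₂ v≈a₂ w)))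
    label-glued (inj₂ (u≈b₁ , v≈b₂)) w =
      trans (label-cong₁ u≈b₁ w)
        (trans (true⇔⇒≡ (image-ba₁⇔ w) (image-ba₂⇔ w)) (sym (label-cong₂ v≈b₂ w)))

    label-cong : ∀ {u v} → u ≈ₚ v → proj₁ (label u) ≗ proj₁ (label v)
    label-cong (same₁ p)  = label-cong₁ p
    label-cong (same₂ p)  = label-cong₂ p
    label-cong (glue₁₂ g) = label-glued g
    label-cong (glue₂₁ g) = sym ∘ label-glued g

    -- Images commute with `Δ` and the translation by the label of `a₁` cancels, so counts made with
    -- `L₁` carry over unchanged.
    diff₁ : ∀ u v → I₁.image (L₁.diff u v) ≗ diff (inj₁ u) (inj₁ v)
    diff₁ u v w = sym (trans (I₁.image-Δ (L₁.diff u a₁) (L₁.diff v a₁) w)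
      (I₁.image-cong (λ x → xor-translate (proj₁ (L₁.label u) x) _ _) w))

    diff₂ : ∀ u v → I₂.image (L₂.diff u v) ≗ diff (inj₂ u) (inj₂ v)
    diff₂ u v w = sym (trans (I₂.image-Δ (L₂.diff u a₂) (L₂.diff v a₂) w)
      (I₂.image-cong (λ x → xor-translate (proj₁ (L₂.label u) x) _ _) w))

    diff-cong : ∀ {u u′ v v′} → u ≈ₚ u′ → v′ ≈ₚ v → diff u′ v′ ≗ diff u v
    diff-cong p q w = cong₂ _xor_ (sym (label-cong p w)) (label-cong q w)

    edge : ∀ {u v} → u ~ₚ v → HasCardinality (diff u v) 1
    edge (_ , _ , p , Pointwise.inj₁ e , q) = HasCardinality-resp-≗ (diff-cong p q)
      (HasCardinality-resp-≗ (diff₁ _ _) (I₁.image-cardinality (L₁.edge e)))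
    edge (_ , _ , p , Pointwise.inj₂ e , q) = HasCardinality-resp-≗ (diff-cong p q)
      (HasCardinality-resp-≗ (diff₂ _ _) (I₂.image-cardinality (L₂.edge e)))

    walk₁ : ∀ {u v n} → Walk G₁ u v n → Walk pasted (inj₁ u) (inj₁ v) n
    walk₁ = Walk-map G₁ pasted inj₁ same₁ λ e → _ , _ , ≈ₚ-refl , Pointwise.inj₁ e , ≈ₚ-refl

    walk₂ : ∀ {u v n} → Walk G₂ u v n → Walk pasted (inj₂ u) (inj₂ v) n
    walk₂ = Walk-map G₂ pasted inj₂ same₂ λ e → _ , _ , ≈ₚ-refl , Pointwise.inj₂ e , ≈ₚ-refl

    -- The labels of `a₁` and `b₁` differ at `x₁`, so any `u` that disagrees with `a₁` there agrees
    -- with `b₁`.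
    gate : ∀ u → ∃[ c₁ ] ∃[ c₂ ] Glued c₁ c₂ × L₁.diff u c₁ x₁ ≡ false
    gate u with L₁.diff u a₁ x₁ in eq
    ... | false = a₁ , a₂ , inj₁ (Setoid.refl G₁.vertices , Setoid.refl G₂.vertices) , eq
    ... | true  = b₁ , b₂ , inj₂ (Setoid.refl G₁.vertices , Setoid.refl G₂.vertices) ,
      trans (sym (xor-telescope (proj₁ (L₁.label u) x₁) (proj₁ (L₁.label a₁) x₁) _))
        (cong₂ _xor_ eq (from (mem₁ x₁) (here refl)))

    cross : ∀ u v →
            ∃[ n ] Walk pasted (inj₁ u) (inj₂ v) n × HasCardinality (diff (inj₁ u) (inj₂ v)) n
    cross u v with c₁ , c₂ , glued , agree ← gate u
              with m , p , cardp ← L₁.geodesic u c₁ | n , q , cardq ← L₂.geodesic c₂ v =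
      m + n
      , Walk-trans pasted (walk₁ p) (Walk-respˡ pasted (glue₂₁ glued) (walk₂ q))
      , HasCardinality-resp-≗ through
          (disjoint-cardinality disj (I₁.image-cardinality cardp) (I₂.image-cardinality cardq))
      where
      disj : ∀ w → I₁.image (L₁.diff u c₁) w ≡ true → I₂.image (L₂.diff c₂ v) w ≡ true → ⊥
      -- The ranges of `left` and `inj₂` meet only in `inj₂ x₂`, which comes from `x₁` alone, and
      -- `gate` excludes `x₁` from the first difference.
      disj w r s with x , ix≡w , r′ ← I₁.image-∈⁻ (L₁.diff u c₁) w r
                 with _ , refl , _  ← I₂.image-∈⁻ (L₂.diff c₂ v) w s
                 with refl , _ ← left≡inj₂⁻ ix≡w =
        contradiction (trans (sym r′) agree) λ ()

      through : I₁.image (L₁.diff u c₁) Δ I₂.image (L₂.diff c₂ v) ≗ diff (inj₁ u) (inj₂ v)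
      -- The sum telescopes at the gate because `c₁` and `c₂` are glued and hence carry equal
      -- labels.
      through w =
        trans (cong₂ _xor_ (diff₁ u c₁ w)
                           (trans (diff₂ c₂ v w) (diff-cong (glue₁₂ glued) (≈ₚ-refl {inj₂ v}) w)))
              (xor-telescope (proj₁ (label (inj₁ u)) w) (proj₁ (label (inj₁ c₁)) w) _)

    geodesic : ∀ u v → ∃[ n ] Walk pasted u v n × HasCardinality (diff u v) n
    geodesic (inj₁ u) (inj₁ v) = let n , p , card = L₁.geodesic u v in
      n , walk₁ p , HasCardinality-resp-≗ (diff₁ u v) (I₁.image-cardinality card)
    geodesic (inj₂ u) (inj₂ v) = let n , p , card = L₂.geodesic u v in
      n , walk₂ p , HasCardinality-resp-≗ (diff₂ u v) (I₂.image-cardinality card)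
    geodesic (inj₁ u) (inj₂ v) = cross u v
    geodesic (inj₂ v) (inj₁ u) = let n , p , card = cross u v in
      n , Walk-sym pasted p ,
      HasCardinality-resp-≗ (λ w → xor-comm (proj₁ (label (inj₁ u)) w) _) card

theorem7p4 : ∀ {ℓ : Level} (G₁ G₂ : Graph ℓ) →
    Connected G₁ → Connected G₂ →
    IsPartialCube G₁ → IsPartialCube G₂ →
    {a₁ b₁ : Graph.V G₁} (a₁b₁ : Graph._~_ G₁ a₁ b₁) →
    {a₂ b₂ : Graph.V G₂} (a₂b₂ : Graph._~_ G₂ a₂ b₂) →
    IsPartialCube (edgePasting G₁ G₂ a₁b₁ a₂b₂)
theorem7p4 G₁ G₂ conn₁ conn₂ pc₁ pc₂ a₁b₁ a₂b₂ =
  labelling⇒partialCube (edgePasting G₁ G₂ a₁b₁ a₂b₂)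
    (pasted-labelling G₁ G₂ a₁b₁ a₂b₂
      (proj₂ (partialCube⇒labelling G₁ conn₁ pc₁))
      (proj₂ (partialCube⇒labelling G₂ conn₂ pc₂)))
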